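{- Let $H$ be a connected, non-trivial graph. Then for all integers $k \ge 2$, $$r(H^{k}) \le rc(H^{k}) \le 2\,r(H^{k}) + 1.$$
   Context: All graphs are finite, simple and undirected. A graph is trivial if it has order (number of vertices) 0 or 1, and non-trivial otherwise. For a connected graph $G$: $dist_G(u,v)$ is the length (number of edges) of a shortest path between $u$ and $v$; the eccentricity of a vertex $v$ is $ecc(v)=\max\{dist_G(v,u): u\in V(G)\}$; the radius is $r(G)=\min\{ecc(v): v\in V(G)\}$. An edge coloring of $G$ is any function from $E(G)$ to a set of colors (not necessarily proper). A path is a rainbow path if no two of its edges have the same color. An edge coloring is a rainbow coloring if every pair of vertices is connected by at least one rainbow path. The rainbow connection number $rc(G)$ of a connected graph $G$ is the minimum number of colors in a rainbow coloring of $G$. The $k$-th power $G^{k}$ ($k\ge 1$) of a graph $G$ has vertex set $V(G)$, and two distinct vertices $u,v$ are adjacent in $G^{k}$ if and only if $dist_G(u,v)\le k$. -}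

module Defs where

open import Data.Empty using (⊥-elim)
open import Data.Fin.Base using (Fin; zero; suc; toℕ; fromℕ<; combine; quotient; remainder; finToFun; funToFin)
open import Data.Fin.Properties
  using (_≟_; any?; all?; toℕ-fromℕ<; injective⇒≤; combine-injective; remQuot-combine; finToFun-funToFin)
  renaming (_≤?_ to _≤ᶠ?_; ≤-antisym to ≤ᶠ-antisym; ≤-total to ≤ᶠ-total)
import Data.List.Base as List
open import Data.List.Base using (List; []; _∷_; [_]; lookup)
open import Data.List.Membership.Propositional using (_∈_)
import Data.List.Membership.DecPropositional as DecMembership
open import Data.List.Membership.Propositional.Properties using (∈-lookup)
import Data.List.Relation.Unary.All as All
open import Data.List.Relation.Unary.All using (All; []; _∷_)
open import Data.List.Relation.Unary.All.Properties using (¬Any⇒All¬)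
open import Data.List.Relation.Unary.AllPairs using ([]; _∷_)
open import Data.List.Relation.Unary.Any using (here; there)
open import Data.List.Relation.Unary.Unique.Propositional using (Unique)
import Data.List.Relation.Unary.Unique.DecPropositional as DecUnique
open import Data.Nat.Base using (ℕ; zero; suc; _+_; _*_; _^_; _≤_; _<_; _⊓_; _⊔_; z≤n; s≤s)
open import Data.Nat.Properties
  using (≤-refl; ≤-reflexive; ≤-trans; m≤n⇒m≤1+n; suc-injective)
import Data.Nat.Properties as ℕ
open import Data.Product.Base using (Σ-syntax; ∃; ∃-syntax; _×_; _,_; proj₁; proj₂)
open import Data.Sum.Base using (_⊎_; inj₁; inj₂)
open import Data.Unit.Base using (⊤; tt)
import Data.Vec.Functional as Vector
open import Function.Base using (_∘_; case_of_)
open import Level using (0ℓ)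
open import Relation.Binary.Construct.Closure.ReflexiveTransitive using (Star; ε; _◅_; _◅◅_; reverse)
open import Relation.Binary.Core using (Rel)
open import Relation.Binary.Definitions using (Symmetric; Irreflexive; Decidable)
open import Relation.Binary.PropositionalEquality
  using (_≡_; _≢_; refl; sym; trans; cong; cong₂; subst; ≢-sym)
open import Relation.Nullary using (Dec; yes; no; ¬?; contradiction)
open import Relation.Nullary.Decidable using (map′; _×-dec_)
import Relation.Unary as U

------------------------------------------------------------------------
-- Minima and maxima

record Minimum (P : ℕ → Set) : Set where
  field
    value   : ℕ
    holds   : P value
    minimal : ∀ {m} → P m → value ≤ m

minimum : ∀ {P : ℕ → Set} → U.Decidable P → ∀ n → P n → Minimum P
minimum P? n pn with P? 0
minimum P? n pn           | yes p₀ = record { value = 0 ; holds = p₀ ; minimal = λ _ → z≤n }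
minimum P? zero pn        | no ¬p₀ = contradiction pn ¬p₀
minimum {P} P? (suc n) pn | no ¬p₀ = record
  { value   = suc value
  ; holds   = holds
  ; minimal = λ { {zero} p₀ → contradiction p₀ ¬p₀ ; {suc m} p → s≤s (minimal p) }
  }
  where open Minimum (minimum {P ∘ suc} (P? ∘ suc) n pn)

max : ∀ {n} → (Fin n → ℕ) → ℕ
max = Vector.foldr _⊔_ 0

-- The value 0 on the empty family is a junk value.
min : ∀ {n} → (Fin n → ℕ) → ℕ
min {zero}  f = 0
min {suc n} f = Vector.foldr _⊓_ (f zero) (f ∘ suc)

------------------------------------------------------------------------
-- Finite simple graphs

record Graph : Set₁ where
  infix 4 _~_ _~?_
  field
    order : ℕ

  Vertex : Set
  Vertex = Fin order

  field
    _~_      : Rel Vertex 0ℓ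
    _~?_     : Decidable _~_
    ~-sym    : Symmetric _~_
    ~-irrefl : Irreflexive _≡_ _~_

  Walk : Rel Vertex 0ℓ
  Walk = Star _~_

  vertices : ∀ {u v} → Walk u v → List Vertex
  vertices {u} ε       = [ u ]
  vertices {u} (_ ◅ w) = u ∷ vertices w

  length : ∀ {u v} → Walk u v → ℕ
  length ε       = 0
  length (_ ◅ w) = suc (length w)

  IsPath : ∀ {u v} → Walk u v → Set
  IsPath w = Unique (vertices w)

  Path : Rel Vertex 0ℓ
  Path u v = Σ[ w ∈ Walk u v ] IsPath w

  Connected : Set
  Connected = ∀ u v → Path u v

  NonTrivial : Set
  NonTrivial = 2 ≤ order

  -- A function on E(G): since colour-sym ranges over all proofs of
  -- adjacency, the colour depends only on the unordered pair {u , v}.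
  record EdgeColouring (C : Set) : Set where
    field
      colour     : ∀ {u v} → u ~ v → C
      colour-sym : ∀ {u v} (e : u ~ v) (e′ : v ~ u) → colour e ≡ colour e′

    colour-irr : ∀ {u v} (e e′ : u ~ v) → colour e ≡ colour e′
    colour-irr e e′ = trans (colour-sym e (~-sym e)) (colour-sym (~-sym e) e′)

    colours : ∀ {u v} → Walk u v → List C
    colours ε       = []
    colours (e ◅ w) = colour e ∷ colours w

    RainbowPath : Rel Vertex 0ℓ
    RainbowPath u v = Σ[ p ∈ Path u v ] Unique (colours (proj₁ p))

    IsRainbowColouring : Set
    IsRainbowColouring = ∀ u v → RainbowPath u v

  open EdgeColouring

  HasRainbowColouring : ℕ → Set
  HasRainbowColouring m = Σ[ χ ∈ EdgeColouring (Fin m) ] IsRainbowColouring χ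

  HasPathOfLength : Vertex → Vertex → ℕ → Set
  HasPathOfLength u v d = Σ[ p ∈ Path u v ] length (proj₁ p) ≡ d

  ----------------------------------------------------------------------
  -- Walks and paths

  length-vertices : ∀ {u v} (w : Walk u v) → List.length (vertices w) ≡ suc (length w)
  length-vertices ε       = refl
  length-vertices (_ ◅ w) = cong suc (length-vertices w)

  private
    lookup-injective : ∀ {A : Set} {xs : List A} → Unique xs →
                       ∀ {i j} → lookup xs i ≡ lookup xs j → i ≡ j
    lookup-injective (_  ∷ _)  {zero}  {zero}  _  = refl
    lookup-injective {xs = _ ∷ xs} (x∉ ∷ _) {zero} {suc j} eq =
      contradiction eq (All.lookup x∉ (∈-lookup {xs = xs} j))
    lookup-injective {xs = _ ∷ xs} (x∉ ∷ _) {suc i} {zero} eq =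
      contradiction (sym eq) (All.lookup x∉ (∈-lookup {xs = xs} i))
    lookup-injective (_ ∷ xs!) {suc i} {suc j} eq = cong suc (lookup-injective xs! eq)

  length<order : ∀ {u v} (w : Walk u v) → IsPath w → length w < order
  length<order w w! =
    subst (_≤ order) (length-vertices w) (injective⇒≤ (lookup-injective w!))

  suffix : ∀ {u v x} (w : Walk u v) → IsPath w → x ∈ vertices w →
           Σ[ p ∈ Path x v ] length (proj₁ p) ≤ length w
  suffix ε       w!       (here refl) = (ε , w!) , z≤n
  suffix (e ◅ w) w!       (here refl) = (e ◅ w , w!) , ≤-refl
  suffix (e ◅ w) (_ ∷ w!) (there x∈w) with suffix w w! x∈w
  ... | p , p≤w = p , m≤n⇒m≤1+n p≤w

  toPath : ∀ {u v} (w : Walk u v) → Σ[ p ∈ Path u v ] length (proj₁ p) ≤ length w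
  toPath ε = (ε , [] ∷ []) , z≤n
  toPath {u} (e ◅ w) with toPath w
  ... | (p , p!) , p≤w with DecMembership._∈?_ _≟_ u (vertices p)
  ...   | yes u∈p = case suffix p p! u∈p of λ
                      { (q , q≤p) → q , m≤n⇒m≤1+n (≤-trans q≤p p≤w) }
  ...   | no  u∉p = (e ◅ p , ¬Any⇒All¬ _ u∉p ∷ p!) , s≤s p≤w

  length-◅◅ : ∀ {u v x} (w : Walk u v) (w′ : Walk v x) →
              length (w ◅◅ w′) ≡ length w + length w′
  length-◅◅ ε       w′ = refl
  length-◅◅ (_ ◅ w) w′ = cong suc (length-◅◅ w w′)

  reverseWalk : ∀ {u v} (w : Walk u v) → Σ[ w′ ∈ Walk v u ] length w′ ≡ length w
  reverseWalk ε       = ε , refl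
  reverseWalk (e ◅ w) with reverseWalk w
  ... | w′ , eq = w′ ◅◅ ~-sym e ◅ ε
                , trans (length-◅◅ w′ (~-sym e ◅ ε)) (trans (ℕ.+-comm _ 1) (cong suc eq))

  ----------------------------------------------------------------------
  -- Decidability

  walkOfLength? : ∀ {C} (χ : EdgeColouring C) (P : List Vertex → List C → Set) →
                  (∀ xs cs → Dec (P xs cs)) → ∀ d u v →
                  Dec (Σ[ w ∈ Walk u v ] length w ≡ d × P (vertices w) (colours χ w))
  walkOfLength? χ P P? zero u v with u ≟ v
  ... | no u≢v   = no λ { (ε , _) → u≢v refl ; (_ ◅ _ , () , _) }
  ... | yes refl = map′ (λ p → ε , refl , p)
                        (λ { (ε , _ , p) → p ; (_ ◅ _ , () , _) })
                        (P? [ u ] [])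
  walkOfLength? {C} χ P P? (suc d) u v = map′
    (λ { (x , e , w , eq , p) → e ◅ w , cong suc eq , p })
    (λ { (ε , () , _) ; (e ◅ w , eq , p) → _ , e , w , suc-injective eq , p })
    (any? step?)
    where
    Step : Vertex → Set
    Step x = Σ[ e ∈ u ~ x ] Σ[ w ∈ Walk x v ]
             length w ≡ d × P (u ∷ vertices w) (colour χ e ∷ colours χ w)

    step? : ∀ x → Dec (Step x)
    step? x with u ~? x
    ... | no ¬e = no (¬e ∘ proj₁)
    ... | yes e = map′ (e ,_)
      (λ { (e′ , w , eq , p) →
           w , eq , subst (λ c → P (u ∷ vertices w) (c ∷ colours χ w)) (colour-irr χ e′ e) p })
      (walkOfLength? χ (λ xs cs → P (u ∷ xs) (colour χ e ∷ cs))
                       (λ xs cs → P? (u ∷ xs) (colour χ e ∷ cs)) d x v)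

  hasPathOfLength? : ∀ u v → U.Decidable (HasPathOfLength u v)
  hasPathOfLength? u v d = map′
    (λ { (w , eq , w!) → (w , w!) , eq })
    (λ { ((w , w!) , eq) → w , eq , w! })
    (walkOfLength? (record { colour = λ _ → tt ; colour-sym = λ _ _ → refl })
       (λ xs _ → Unique xs) (λ xs _ → DecUnique.unique? _≟_ xs) d u v)

  rainbowPath? : ∀ {m} (χ : EdgeColouring (Fin m)) → Decidable (RainbowPath χ)
  rainbowPath? χ u v = map′
    (λ { (_ , w , _ , w! , c!) → (w , w!) , c! })
    (λ { ((w , w!) , c!) →
         fromℕ< (length<order w w!) , w , sym (toℕ-fromℕ< (length<order w w!)) , w! , c! })
    (any? λ (d : Fin order) → walkOfLength? χ
      (λ xs cs → Unique xs × Unique cs)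
      (λ xs cs → DecUnique.unique? _≟_ xs ×-dec DecUnique.unique? _≟_ cs) (toℕ d) u v)

  isRainbowColouring? : ∀ {m} → U.Decidable (IsRainbowColouring {Fin m})
  isRainbowColouring? χ = all? λ u → all? λ v → rainbowPath? χ u v

  module _ {C} (χ χ′ : EdgeColouring C)
           (χ≗χ′ : ∀ {u v} (e : u ~ v) → colour χ e ≡ colour χ′ e) where

    colours-cong : ∀ {u v} (w : Walk u v) → colours χ w ≡ colours χ′ w
    colours-cong ε       = refl
    colours-cong (e ◅ w) = cong₂ _∷_ (χ≗χ′ e) (colours-cong w)

    isRainbowColouring-resp : IsRainbowColouring χ → IsRainbowColouring χ′
    isRainbowColouring-resp rb u v with rb u v
    ... | p , c! = p , subst Unique (colours-cong (proj₁ p)) c!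

  fromSymmetric : ∀ {C} (f : Vertex → Vertex → C) → (∀ u v → f u v ≡ f v u) → EdgeColouring C
  fromSymmetric f f-sym = record
    { colour     = λ {u} {v} _ → f u v
    ; colour-sym = λ {u} {v} _ _ → f-sym u v
    }

  hasRainbowColouring? : U.Decidable HasRainbowColouring
  hasRainbowColouring? zero with any? (λ u → any? (λ v → u ~? v))
  ... | yes (_ , _ , e) = no λ { (χ , _) → case colour χ e of λ () }
  ... | no ¬e = map′ (χ₀ ,_)
      (λ { (χ , rb) → isRainbowColouring-resp χ χ₀ (λ e → ⊥-elim (¬e (_ , _ , e))) rb })
      (isRainbowColouring? χ₀)
    where
    χ₀ : EdgeColouring (Fin 0)
    χ₀ = record { colour     = λ e → ⊥-elim (¬e (_ , _ , e))
                ; colour-sym = λ e → ⊥-elim (¬e (_ , _ , e)) }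
  hasRainbowColouring? (suc m) = map′
    (λ { (_ , f-sym , rb) → fromSymmetric _ f-sym , rb })
    encode
    (any? λ i → good? (decode i))
    where
    decode : Fin (suc m ^ (order * order)) → Vertex → Vertex → Fin (suc m)
    decode i u v = finToFun i (combine u v)

    Good : (Vertex → Vertex → Fin (suc m)) → Set
    Good f = Σ[ f-sym ∈ (∀ u v → f u v ≡ f v u) ] IsRainbowColouring (fromSymmetric f f-sym)

    good? : U.Decidable Good
    good? f with all? (λ u → all? (λ v → f u v ≟ f v u))
    ... | no ¬f-sym = no (¬f-sym ∘ proj₁)
    ... | yes f-sym = map′ (f-sym ,_)
      (λ { (f-sym′ , rb) →
           isRainbowColouring-resp (fromSymmetric f f-sym′) (fromSymmetric f f-sym) (λ _ → refl) rb })
      (isRainbowColouring? (fromSymmetric f f-sym))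

    encode : HasRainbowColouring (suc m) → ∃[ i ] Good (decode i)
    encode (χ , rb) = i , g-sym , isRainbowColouring-resp χ (fromSymmetric _ g-sym) agree rb
      where
      f : Vertex → Vertex → Fin (suc m)
      f u v with u ~? v
      ... | yes e = colour χ e
      ... | no  _ = zero

      f-sym : ∀ u v → f u v ≡ f v u
      f-sym u v with u ~? v | v ~? u
      ... | yes e | yes e′ = colour-sym χ e e′
      ... | yes e | no ¬e′ = contradiction (~-sym e) ¬e′
      ... | no ¬e | yes e′ = contradiction (~-sym e′) ¬e
      ... | no _  | no _   = refl

      f-colour : ∀ {u v} (e : u ~ v) → colour χ e ≡ f u v
      f-colour {u} {v} e with u ~? v
      ... | yes e′ = colour-irr χ e e′
      ... | no  ¬e = contradiction e ¬e

      unpair : Fin (order * order) → Fin (suc m)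
      unpair k = f (quotient order k) (remainder {order} order k)

      i : Fin (suc m ^ (order * order))
      i = funToFin unpair

      decode-i : ∀ u v → decode i u v ≡ f u v
      decode-i u v = trans (finToFun-funToFin unpair (combine u v))
        (cong (λ q → f (proj₁ q) (proj₂ q)) (remQuot-combine {order} u v))

      g-sym : ∀ u v → decode i u v ≡ decode i v u
      g-sym u v = trans (decode-i u v) (trans (f-sym u v) (sym (decode-i v u)))

      agree : ∀ {u v} (e : u ~ v) → colour χ e ≡ decode i u v
      agree {u} {v} e = trans (f-colour e) (sym (decode-i u v))

  ----------------------------------------------------------------------
  -- Colouring all edges differently is a rainbow colouring

  private
    code : Vertex → Vertex → Fin (order * order)
    code u v with u ≤ᶠ? v
    ... | yes _ = combine u v
    ... | no  _ = combine v u

    code-sym : ∀ u v → code u v ≡ code v u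
    code-sym u v with u ≤ᶠ? v | v ≤ᶠ? u
    ... | yes u≤v | yes v≤u = cong₂ combine (≤ᶠ-antisym u≤v v≤u) (≤ᶠ-antisym v≤u u≤v)
    ... | yes _   | no  _   = refl
    ... | no  _   | yes _   = refl
    ... | no u≰v  | no v≰u  with ≤ᶠ-total u v
    ...   | inj₁ u≤v = contradiction u≤v u≰v
    ...   | inj₂ v≤u = contradiction v≤u v≰u

    code-injective : ∀ u v x y → code u v ≡ code x y → u ≡ x ⊎ u ≡ y
    code-injective u v x y eq with u ≤ᶠ? v | x ≤ᶠ? y
    ... | yes _ | yes _ = inj₁ (proj₁ (combine-injective u v x y eq))
    ... | yes _ | no  _ = inj₂ (proj₁ (combine-injective u v y x eq))
    ... | no  _ | yes _ = inj₂ (proj₂ (combine-injective v u x y eq))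
    ... | no  _ | no  _ = inj₁ (proj₂ (combine-injective v u y x eq))

    distinct : EdgeColouring (Fin (order * order))
    distinct = fromSymmetric code code-sym

    first-vertex : ∀ {u v} {P : Vertex → Set} (w : Walk u v) → All P (vertices w) → P u
    first-vertex ε       (p ∷ _) = p
    first-vertex (_ ◅ _) (p ∷ _) = p

    fresh : ∀ {u v} x y (w : Walk u v) → All (x ≢_) (vertices w) →
            All (code x y ≢_) (colours distinct w)
    fresh x y ε ps = []
    fresh {u} x y (_◅_ {j = z} e w) (x≢u ∷ ps) =
      (λ eq → case code-injective x y u z eq of λ
        { (inj₁ x≡u) → x≢u x≡u ; (inj₂ x≡z) → first-vertex w ps x≡z })
      ∷ fresh x y w ps

    path-distinct : ∀ {u v} (w : Walk u v) → IsPath w → Unique (colours distinct w)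
    path-distinct ε       _         = []
    path-distinct {u} (_◅_ {j = z} e w) (u∉w ∷ w!) = fresh u z w u∉w ∷ path-distinct w w!

  hasRainbowColouring : Connected → ∃ HasRainbowColouring
  hasRainbowColouring conn = order * order , distinct , λ u v →
    conn u v , path-distinct (proj₁ (conn u v)) (proj₂ (conn u v))

------------------------------------------------------------------------
-- Connected graphs

record ConnectedGraph : Set₁ where
  field
    graph     : Graph
    connected : Graph.Connected graph

  open Graph graph public

  dist-minimum : ∀ u v → Minimum (HasPathOfLength u v)
  dist-minimum u v = minimum (hasPathOfLength? u v) _ (connected u v , refl)

  dist : Vertex → Vertex → ℕ
  dist u v = Minimum.value (dist-minimum u v)

  ecc : Vertex → ℕ
  ecc v = max (λ u → dist v u)

  radius : ℕ
  radius = min ecc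

  -- A colouring need not use all m available colours, but one that does
  -- not is never minimising.
  rc-minimum : Minimum HasRainbowColouring
  rc-minimum = minimum hasRainbowColouring? _ (proj₂ (hasRainbowColouring connected))

  rc : ℕ
  rc = Minimum.value rc-minimum

  dist≤length : ∀ {u v} (w : Walk u v) → dist u v ≤ length w
  dist≤length {u} {v} w with toPath w
  ... | p , p≤w = ≤-trans (Minimum.minimal (dist-minimum u v) (p , refl)) p≤w

  dist-sym : ∀ u v → dist u v ≤ dist v u
  dist-sym u v with Minimum.holds (dist-minimum v u)
  ... | (w , _) , eq with reverseWalk w
  ...   | w′ , eq′ = ≤-trans (dist≤length w′) (≤-reflexive (trans eq′ eq))

open ConnectedGraph using (graph; radius; rc) public

------------------------------------------------------------------------
-- Graph powers

module _ (H : ConnectedGraph) (k : ℕ) where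
  open ConnectedGraph H hiding (graph)

  powerGraph : Graph
  powerGraph = record
    { order    = order
    ; _~_      = λ u v → u ≢ v × dist u v ≤ k
    ; _~?_     = λ u v → ¬? (u ≟ v) ×-dec (dist u v ℕ.≤? k)
    ; ~-sym    = λ { {u} {v} (u≢v , d≤k) → ≢-sym u≢v , ≤-trans (dist-sym v u) d≤k }
    ; ~-irrefl = λ { u≡v (u≢v , _) → u≢v u≡v }
    }

  module _ (1≤k : 1 ≤ k) where

    private
      walk⁺ : ∀ {u v} → Walk u v → Graph.Walk powerGraph u v
      walk⁺ ε       = ε
      walk⁺ (e ◅ w) =
        ((λ u≡v → ~-irrefl u≡v e) , ≤-trans (dist≤length (e ◅ ε)) 1≤k) ◅ walk⁺ w

      vertices-walk⁺ : ∀ {u v} (w : Walk u v) → Graph.vertices powerGraph (walk⁺ w) ≡ vertices w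
      vertices-walk⁺ ε       = refl
      vertices-walk⁺ (e ◅ w) = cong (_ ∷_) (vertices-walk⁺ w)

    power : ConnectedGraph
    power = record
      { graph     = powerGraph
      ; connected = λ u v → case connected u v of λ
          { (w , w!) → walk⁺ w , subst Unique (sym (vertices-walk⁺ w)) w! }
      }

{-# OPTIONS --safe #-}

-- For the upper bound let c be a centre of Hᵏ and r its eccentricity, so that
-- every vertex has depth (distance to c in H) at most r k.  Besides one
-- "flat" colour there are two colours, of parities 0ℙ and 1ℙ, for each of the
-- r layers (i k , (i + 1) k] of depths.  Edges from layer i + 1 to depth
-- (i + 1) k have parity 0ℙ, those to depth (i + 1) k − 1 have parity 1ℙ; edges
-- from layer 0 to c alternate with the depth.  Every vertex then descends
-- to c along colours of a single parity, and every vertex of depth at least 2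
-- also does so in the other parity after a flat edge to a neighbour of
-- smaller depth.  Hence any two vertices are joined through c, except
-- two vertices of depth 1, which are adjacent because k ≥ 2.
module Submission where

open import Defs
open import Data.Fin.Base using (Fin; zero; suc; toℕ; fromℕ<)
open import Data.Fin.Properties using (_≟_; toℕ-fromℕ<; toℕ-injective; injective⇒≤)
open import Data.List.Base using (List; []; _∷_; _++_; map; _ʳ++_; lookup)
open import Data.List.Membership.Propositional using (_∈_)
import Data.List.Membership.DecPropositional as DecMembership
open import Data.List.Membership.Propositional.Properties using (∈-lookup)
open import Data.List.Relation.Binary.Disjoint.Propositional using (Disjoint)
open import Data.List.Relation.Binary.Permutation.Propositional using (↭-sym; ↭⇒↭ₛ)
open import Data.List.Relation.Binary.Permutation.Propositional.Properties using (↭-reverse)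
open import Data.List.Relation.Binary.Permutation.Setoid.Properties using (Unique-resp-↭)
open import Data.List.Relation.Binary.Subset.Propositional using (_⊆_)
open import Data.List.Relation.Binary.Subset.Propositional.Properties using (All-resp-⊇; ∷⁺ʳ)
open import Data.List.Relation.Unary.All as All using (All; []; _∷_)
open import Data.List.Relation.Unary.All.Properties using (¬Any⇒All¬)
open import Data.List.Relation.Unary.AllPairs using ([]; _∷_)
open import Data.List.Relation.Unary.Any using (here; there)
open import Data.List.Relation.Unary.Any.Properties using (reverse⁻)
open import Data.List.Relation.Unary.Unique.Propositional using (Unique)
open import Data.List.Relation.Unary.Unique.Propositional.Properties using (++⁺; map⁺; map⁻)
open import Data.Nat.Base
  using (ℕ; zero; suc; _+_; _*_; _∸_; _⊔_; _⊓_; _≤_; _<_; z≤n; s≤s; s≤s⁻¹; parity; _/_; _%_)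
open import Data.Nat.DivMod
  using (m≡m%n+[m/n]*n; m%n<n; m*n/n≡m; m<n⇒m/n≡0; m<n*o⇒m/o<n; +-distrib-/-∣ʳ; [m+kn]%n≡m%n; m<n⇒m%n≡m)
open import Data.Nat.Divisibility using (n∣m*n)
open import Data.Nat.Properties hiding (_≟_)
import Data.Nat.Properties as ℕ
open import Data.Parity.Base using (Parity; 0ℙ; 1ℙ; _⁻¹)
import Data.Parity.Properties as ℙ
open import Data.Product.Base using (Σ-syntax; ∃-syntax; _×_; _,_; proj₁)
open import Data.Sum.Base using (_⊎_; inj₁; inj₂)
import Data.Vec.Functional as Vector
open import Function.Base using (_∘_; case_of_)
open import Relation.Binary.Construct.Closure.ReflexiveTransitive
  using (ε; _◅_; _◅◅_; revApp; reverse)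
open import Relation.Binary.PropositionalEquality
  using (_≡_; _≢_; refl; sym; trans; cong; cong₂; subst; setoid; module ≡-Reasoning)
open import Relation.Nullary using (yes; no; contradiction)

-- Extrema of finite families

max-lub : ∀ {n b} (f : Fin n → ℕ) → (∀ i → f i ≤ b) → max f ≤ b
max-lub {zero}  f f≤b = z≤n
max-lub {suc n} f f≤b = ⊔-lub (f≤b zero) (max-lub (f ∘ suc) (f≤b ∘ suc))

≤-max : ∀ {n} (f : Fin n → ℕ) i → f i ≤ max f
≤-max f zero    = m≤m⊔n (f zero) _
≤-max f (suc i) = ≤-trans (≤-max (f ∘ suc) i) (m≤n⊔m (f zero) _)

foldr-⊓-sel : ∀ {n} a (f : Fin n → ℕ) →
              Vector.foldr _⊓_ a f ≡ a ⊎ ∃[ i ] Vector.foldr _⊓_ a f ≡ f i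
foldr-⊓-sel {zero}  a f = inj₁ refl
foldr-⊓-sel {suc n} a f with ⊓-sel (f zero) (Vector.foldr _⊓_ a (f ∘ suc)) | foldr-⊓-sel a (f ∘ suc)
... | inj₁ eq | _              = inj₂ (zero , eq)
... | inj₂ eq | inj₁ eq′       = inj₁ (trans eq eq′)
... | inj₂ eq | inj₂ (i , eq′) = inj₂ (suc i , trans eq eq′)

min-attained : ∀ {n} → 1 ≤ n → (f : Fin n → ℕ) → ∃[ i ] min f ≡ f i
min-attained {suc n} _ f with foldr-⊓-sel (f zero) (f ∘ suc)
... | inj₁ eq       = zero , eq
... | inj₂ (i , eq) = suc i , eq

lookup-injective : ∀ {A : Set} {xs : List A} → Unique xs →
                   ∀ {i j} → lookup xs i ≡ lookup xs j → i ≡ j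
lookup-injective (_  ∷ _)   {zero}  {zero}  _  = refl
lookup-injective {xs = _ ∷ xs} (x∉ ∷ _) {zero}  {suc j} eq =
  contradiction eq (All.lookup x∉ (∈-lookup {xs = xs} j))
lookup-injective {xs = _ ∷ xs} (x∉ ∷ _) {suc i} {zero}  eq =
  contradiction (sym eq) (All.lookup x∉ (∈-lookup {xs = xs} i))
lookup-injective (_ ∷ xs!) {suc i} {suc j} eq = cong suc (lookup-injective xs! eq)

-- Rainbow walks, loop erasure and renaming of colours

module Rainbow (G : Graph) {C : Set} (χ : Graph.EdgeColouring G C) where
  open Graph G
  open EdgeColouring χ

  length-colours : ∀ {u v} (w : Walk u v) → Data.List.Base.length (colours w) ≡ length w
  length-colours ε       = refl
  length-colours (_ ◅ w) = cong suc (length-colours w)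

  colours-◅◅ : ∀ {u v x} (w : Walk u v) (w′ : Walk v x) → colours (w ◅◅ w′) ≡ colours w ++ colours w′
  colours-◅◅ ε       w′ = refl
  colours-◅◅ (e ◅ w) w′ = cong (colour e ∷_) (colours-◅◅ w w′)

  colours-revApp : ∀ {u v x} (w : Walk u v) (w′ : Walk u x) →
                   colours (revApp ~-sym w w′) ≡ colours w ʳ++ colours w′
  colours-revApp ε       w′ = refl
  colours-revApp (e ◅ w) w′ =
    trans (colours-revApp w (~-sym e ◅ w′))
          (cong (λ c → colours w ʳ++ (c ∷ colours w′)) (colour-sym (~-sym e) e))

  -- The path may start elsewhere than `w`, so that suffixes count. Containment of colours ensures
  -- that a colour absent from `w` is absent from the path too.
  Shortcut : ∀ {u v x} → Walk x v → Set
  Shortcut {u} {v} w = Σ[ p ∈ RainbowPath u v ] colours (proj₁ (proj₁ p)) ⊆ colours w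

  suffixShortcut : ∀ {u v x} (w : Walk u v) → IsPath w → Unique (colours w) →
                   x ∈ vertices w → Shortcut {x} w
  suffixShortcut ε       w!       c!       (here refl) = ((ε , w!) , c!) , λ c∈ → c∈
  suffixShortcut (e ◅ w) w!       c!       (here refl) = ((e ◅ w , w!) , c!) , λ c∈ → c∈
  suffixShortcut (e ◅ w) (_ ∷ w!) (_ ∷ c!) (there x∈w) with suffixShortcut w w! c! x∈w
  ... | p , p⊆w = p , λ c∈ → there (p⊆w c∈)

  -- Loop erasure: if `u` recurs on the path found so far, that path is cut to its suffix at `u`;
  -- deleting edges cannot repeat a colour.
  shortcut : ∀ {u v} (w : Walk u v) → Unique (colours w) → Shortcut {u} w
  shortcut ε c! = ((ε , [] ∷ []) , []) , λ c∈ → c∈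
  shortcut {u} (e ◅ w) (c∉w ∷ c!) with shortcut w c!
  ... | ((p , p!) , cp!) , p⊆w with DecMembership._∈?_ _≟_ u (vertices p)
  ...   | no  u∉p = ((e ◅ p , ¬Any⇒All¬ _ u∉p ∷ p!) , All-resp-⊇ p⊆w c∉w ∷ cp!) , ∷⁺ʳ _ p⊆w
  ...   | yes u∈p with suffixShortcut p p! cp! u∈p
  ...     | q , q⊆p = q , λ c∈ → there (p⊆w (q⊆p c∈))

  -- Reversal only permutes the colours of `w′`. The walks may share vertices, since `shortcut`
  -- removes the loops.
  joinAt : ∀ {u v x} (w : Walk u x) (w′ : Walk v x) → Unique (colours w) → Unique (colours w′) →
           Disjoint (colours w) (colours w′) → RainbowPath u v
  joinAt w w′ w! w′! w#w′ = proj₁ (shortcut (w ◅◅ reverse ~-sym w′)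
    (subst Unique (sym (trans (colours-◅◅ w _) (cong (colours w ++_) (colours-revApp w′ ε))))
      (++⁺ w! (Unique-resp-↭ (setoid C) (↭⇒↭ₛ (↭-sym (↭-reverse _))) w′!)
              λ { (c∈w , c∈w′) → w#w′ (c∈w , reverse⁻ c∈w′) })))

  -- Reversing the path is easiest by rejoining its two ends.
  rainbowPath-sym : ∀ {u v} → RainbowPath u v → RainbowPath v u
  rainbowPath-sym ((w , _) , c!) = joinAt ε w [] c! λ { (() , _) }

  module _ {m} (rank : C → ℕ) (rank-injective : ∀ {x y} → rank x ≡ rank y → x ≡ y)
           (rank< : ∀ {u v} (e : u ~ v) → rank (colour e) < m) where

    -- The bound on `rank` is asked at edges only, so `C` may be infinite, as `Colour` below is.
    ranked : EdgeColouring (Fin m)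
    ranked = record
      { colour     = λ e → fromℕ< (rank< e)
      ; colour-sym = λ e e′ → toℕ-injective (trans (toℕ-fromℕ< (rank< e))
                       (trans (cong rank (colour-sym e e′)) (sym (toℕ-fromℕ< (rank< e′)))))
      }

    toℕ-colours-ranked : ∀ {u v} (w : Walk u v) →
                         map rank (colours w) ≡ map toℕ (EdgeColouring.colours ranked w)
    toℕ-colours-ranked ε       = refl
    toℕ-colours-ranked (e ◅ w) = cong₂ _∷_ (sym (toℕ-fromℕ< (rank< e))) (toℕ-colours-ranked w)

    relabel : IsRainbowColouring → HasRainbowColouring m
    relabel rb = ranked , λ u v → case rb u v of λ
      { (p , c!) → p , map⁻ (subst Unique (toℕ-colours-ranked (proj₁ p)) (map⁺ rank-injective c!)) }

-- Distances, centres and the lower bound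

module Distance (H : ConnectedGraph) where
  open ConnectedGraph H hiding (graph; radius; rc)

  geodesic : ∀ u v → Σ[ w ∈ Walk u v ] length w ≡ dist u v
  geodesic u v with Minimum.holds (dist-minimum u v)
  ... | (w , _) , eq = w , eq

  dist-triangle : ∀ u v x → dist u x ≤ dist u v + dist v x
  dist-triangle u v x with geodesic u v | geodesic v x
  ... | w , eq | w′ , eq′ =
    ≤-trans (dist≤length (w ◅◅ w′)) (≤-reflexive (trans (length-◅◅ w w′) (cong₂ _+_ eq eq′)))

  dist-refl : ∀ v → dist v v ≡ 0
  dist-refl v = n≤0⇒n≡0 (dist≤length (ε {x = v}))

  dist≡0⇒≡ : ∀ {u v} → dist u v ≡ 0 → u ≡ v
  dist≡0⇒≡ {u} {v} d≡0 with geodesic u v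
  ... | ε     , _  = refl
  ... | _ ◅ _ , eq = case trans eq d≡0 of λ ()

  splitWalk : ∀ {u v} (w : Walk u v) j {m} → length w ≡ j + m →
              ∃[ x ] Σ[ w₁ ∈ Walk u x ] Σ[ w₂ ∈ Walk x v ] length w₁ ≡ j × length w₂ ≡ m
  splitWalk w       zero    eq = _ , ε , w , refl , eq
  splitWalk (e ◅ w) (suc j) eq with splitWalk w j (suc-injective eq)
  ... | x , w₁ , w₂ , eq₁ , eq₂ = x , e ◅ w₁ , w₂ , cong suc eq₁ , eq₂

  -- The vertex is taken on a geodesic; by the triangle inequality the rest of the geodesic is
  -- itself shortest.
  between : ∀ {u v} j {m} → dist u v ≡ j + m → ∃[ x ] dist u x ≤ j × dist x v ≡ m
  between {u} {v} j {m} eq with geodesic u v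
  ... | w , len with splitWalk w j (trans len eq)
  ...   | x , w₁ , w₂ , refl , refl =
    x , dist≤length w₁ , ≤-antisym (dist≤length w₂) (+-cancelˡ-≤ j _ _ (begin
      j + length w₂         ≡⟨ sym eq ⟩
      dist u v              ≤⟨ dist-triangle u x v ⟩
      dist u x + dist x v   ≤⟨ +-monoˡ-≤ (dist x v) (dist≤length w₁) ⟩
      j + dist x v          ∎))
    where open ≤-Reasoning

  centre : 1 ≤ order → ∃[ c ] radius H ≡ ecc c
  centre 1≤n = min-attained 1≤n ecc

  dist≤ecc : ∀ u v → dist u v ≤ ecc u
  dist≤ecc u v = ≤-max (dist u) v

  rc≤ : ∀ {m} → HasRainbowColouring m → rc H ≤ m
  rc≤ = Minimum.minimal rc-minimum

  -- A rainbow path has at most as many edges as there are colours.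
  dist≤rc : ∀ u v → dist u v ≤ rc H
  dist≤rc u v with Minimum.holds rc-minimum
  ... | χ , rb with rb u v
  ...   | (w , _) , c! = ≤-trans (dist≤length w)
    (subst (_≤ rc H) (Rainbow.length-colours (graph H) χ w) (injective⇒≤ (lookup-injective c!)))

  radius≤rc : 1 ≤ order → radius H ≤ rc H
  radius≤rc 1≤n with centre 1≤n
  ... | c , eq = ≤-trans (≤-reflexive eq) (max-lub (dist c) (dist≤rc c))

-- Colours, their numbering and the layers of depths

data Colour : Set where
  flat : Colour
  rung : ℕ → Parity → Colour

-- The rungs with index below r take the numbers 1 to 2 r; with 0 this makes the 2 r + 1 colours of
-- the bound.
rank : Colour → ℕ
rank flat        = 0
rank (rung i 0ℙ) = suc (2 * i)
rank (rung i 1ℙ) = suc (suc (2 * i))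

rank-injective : ∀ {x y} → rank x ≡ rank y → x ≡ y
rank-injective {flat}      {flat}      _  = refl
rank-injective {rung i 0ℙ} {rung j 0ℙ} eq =
  cong (λ n → rung n 0ℙ) (*-cancelˡ-≡ i j 2 (suc-injective eq))
rank-injective {rung i 0ℙ} {rung j 1ℙ} eq = contradiction (suc-injective eq) (even≢odd i j)
rank-injective {rung i 1ℙ} {rung j 0ℙ} eq = contradiction (sym (suc-injective eq)) (even≢odd j i)
rank-injective {rung i 1ℙ} {rung j 1ℙ} eq =
  cong (λ n → rung n 1ℙ) (*-cancelˡ-≡ i j 2 (suc-injective (suc-injective eq)))
rank-injective {flat}      {rung _ 0ℙ} ()
rank-injective {flat}      {rung _ 1ℙ} ()
rank-injective {rung _ 0ℙ} {flat}      ()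
rank-injective {rung _ 1ℙ} {flat}      ()

rank-rung< : ∀ {i r} b → i < r → rank (rung i b) < 2 * r + 1
rank-rung< {i} {r} b i<r = begin
  suc (rank (rung i b))  ≤⟨ s≤s (rank≤ b) ⟩
  suc (suc (suc (2 * i))) ≡⟨ cong suc (sym (*-suc 2 i)) ⟩
  suc (2 * suc i)        ≤⟨ s≤s (*-monoʳ-≤ 2 i<r) ⟩
  suc (2 * r)            ≡⟨ +-comm 1 (2 * r) ⟩
  2 * r + 1              ∎
  where
  open ≤-Reasoning
  rank≤ : ∀ b → rank (rung i b) ≤ suc (suc (2 * i))
  rank≤ 0ℙ = n≤1+n _
  rank≤ 1ℙ = ≤-refl

rung-injectiveˡ : ∀ {i j b c} → rung i b ≡ rung j c → i ≡ j
rung-injectiveˡ refl = refl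

rung-injectiveʳ : ∀ {i j b c} → rung i b ≡ rung j c → b ≡ c
rung-injectiveʳ refl = refl

-- Here k = 2 + κ.  A depth d ≥ 1 has coordinates (i , s) with
-- d = i k + s + 1 and s ≤ 1 + κ.
module Layers (κ : ℕ) where

  k : ℕ
  k = suc (suc κ)

  -- The two depths of layer i at which edges from layer i + 1 may end:
  -- (i + 1) k for parity 0ℙ and (i + 1) k − 1 for parity 1ℙ.
  offset : Parity → ℕ
  offset 0ℙ = suc κ
  offset 1ℙ = κ

  station : Parity → ℕ → ℕ
  station b i = i * k + suc (offset b)

  offset≤ : ∀ b → offset b ≤ suc κ
  offset≤ 0ℙ = ≤-refl
  offset≤ 1ℙ = n≤1+n κ

  station≤ : ∀ b i → station b i ≤ suc i * k
  station≤ b i = ≤-trans (+-monoʳ-≤ (i * k) (s≤s (offset≤ b))) (≤-reflexive (+-comm (i * k) k))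

  station-0≢1 : ∀ i → station 0ℙ i ≢ station 1ℙ i
  station-0≢1 i eq = 1+n≢n (+-cancelˡ-≡ (i * k) _ _ eq)

  layerColour : ℕ → ℕ → ℕ → Colour
  -- Parity is counted down from the top depth k, so that the stations of layer 0, at depths k and k
  -- - 1, get rungs of their own parity.
  layerColour zero    s zero    = rung 0 (parity (suc κ ∸ s))
  layerColour zero    s (suc m) = flat
  layerColour (suc i) s m with m ℕ.≟ station 0ℙ i | m ℕ.≟ station 1ℙ i
  ... | yes _ | _     = rung (suc i) 0ℙ
  ... | no _  | yes _ = rung (suc i) 1ℙ
  ... | no _  | no _  = flat

  layerColour-station : ∀ b i s → layerColour (suc i) s (station b i) ≡ rung (suc i) b
  layerColour-station 0ℙ i s with station 0ℙ i ℕ.≟ station 0ℙ i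
  ... | yes _ = refl
  ... | no ≢  = contradiction refl ≢
  layerColour-station 1ℙ i s with station 1ℙ i ℕ.≟ station 0ℙ i | station 1ℙ i ℕ.≟ station 1ℙ i
  ... | yes eq | _     = contradiction (sym eq) (station-0≢1 i)
  ... | no _   | yes _ = refl
  ... | no _   | no ≢  = contradiction refl ≢

  -- Both stations lie in layer i, so an edge that stays within layer i + 1 ends at neither.
  layerColour-flat : ∀ i s {m} → suc i * k < m → layerColour (suc i) s m ≡ flat
  layerColour-flat i s {m} lt with m ℕ.≟ station 0ℙ i | m ℕ.≟ station 1ℙ i
  ... | yes refl | _        = contradiction (station≤ 0ℙ i) (<⇒≱ lt)
  ... | no _     | yes refl = contradiction (station≤ 1ℙ i) (<⇒≱ lt)
  ... | no _     | no _     = refl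

  rank-layerColour< : ∀ {r} i s m → i < r → rank (layerColour i s m) < 2 * r + 1
  rank-layerColour< {r} zero s zero    i<r = rank-rung< {0} (parity (suc κ ∸ s)) i<r
  rank-layerColour< {r} zero s (suc m) i<r = ≤-trans (s≤s z≤n) (≤-reflexive (+-comm 1 (2 * r)))
  rank-layerColour< {r} (suc i) s m i<r with m ℕ.≟ station 0ℙ i | m ℕ.≟ station 1ℙ i
  ... | yes _ | _     = rank-rung< 0ℙ i<r
  ... | no _  | yes _ = rank-rung< 1ℙ i<r
  ... | no _  | no _  = ≤-trans (s≤s z≤n) (≤-reflexive (+-comm 1 (2 * r)))

  -- The colour of an edge from depth d to a smaller depth m.
  downColour : ℕ → ℕ → Colour
  downColour zero    m = flat
  downColour (suc e) m = layerColour (e / k) (e % k) m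

  downColour-coords : ∀ i s m → s ≤ suc κ → downColour (i * k + suc s) m ≡ layerColour i s m
  downColour-coords i s m s≤ = begin
    downColour (i * k + suc s) m ≡⟨ cong (λ d → downColour d m) (+-comm (i * k) (suc s)) ⟩
    layerColour ((s + i * k) / k) ((s + i * k) % k) m ≡⟨ cong₂ (λ a b → layerColour a b m) quot rem ⟩
    layerColour i s m ∎
    where
    open ≡-Reasoning
    quot : (s + i * k) / k ≡ i
    quot = trans (+-distrib-/-∣ʳ s (n∣m*n i)) (cong₂ _+_ (m<n⇒m/n≡0 (s≤s s≤)) (m*n/n≡m i k))
    rem : (s + i * k) % k ≡ s
    rem = trans ([m+kn]%n≡m%n s i k) (m<n⇒m%n≡m (s≤s s≤))

  rank-downColour< : ∀ {r d} m → d ≤ r * k → rank (downColour d m) < 2 * r + 1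
  -- No edge has both ends at depth 0, so `flat` is a filler value here.
  rank-downColour< {r} {zero}  m _   = ≤-trans (s≤s z≤n) (≤-reflexive (+-comm 1 (2 * r)))
  rank-downColour< {r} {suc e} m d≤ = rank-layerColour< (e / k) (e % k) m (m<n*o⇒m/o<n {n = r} d≤)

  -- The number of steps, less one, from (i + 1 , s) to the station of
  -- parity b in layer i.
  gap : Parity → ℕ → ℕ
  gap 0ℙ s = s
  gap 1ℙ s = suc s

  gap-station : ∀ b i s → suc i * k + suc s ≡ suc (gap b s) + station b i
  gap-station 0ℙ i s = begin
    k + i * k + suc s   ≡⟨ +-comm (k + i * k) (suc s) ⟩
    suc s + (k + i * k) ≡⟨ cong (suc s +_) (+-comm k (i * k)) ⟩
    suc s + (i * k + k) ∎
    where open ≡-Reasoning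
  gap-station 1ℙ i s = trans (gap-station 0ℙ i s)
    (trans (cong (suc s +_) (+-suc (i * k) (suc κ))) (+-suc (suc s) (i * k + suc κ)))

  -- A vertex with coordinates (i , s) can descend to the root by b-rungs.
  Descends : Parity → ℕ → ℕ → Set
  Descends b zero    s = b ≡ parity (suc κ ∸ s)
  Descends b (suc i) s = gap b s ≤ suc κ

  -- Rungs of one parity chain together, because consecutive stations of that parity are exactly k
  -- apart.
  descends-station : ∀ b i → Descends b i (offset b)
  descends-station 0ℙ zero    = cong parity (sym (n∸n≡0 κ))
  descends-station 1ℙ zero    = cong parity (sym (m+n∸n≡m 1 κ))
  descends-station 0ℙ (suc i) = ≤-refl
  descends-station 1ℙ (suc i) = ≤-refl

  -- A vertex with coordinates (i , s) has a neighbour, one step closer to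
  -- the root and joined by a flat edge, that descends by b-rungs.
  DescendsAfterFlat : Parity → ℕ → ℕ → Set
  DescendsAfterFlat b i s =
    ∃[ s′ ] s ≡ suc s′ × Descends b i s′ × ∀ t → layerColour i t (i * k + s) ≡ flat

  parity-∸-suc : ∀ {n s} → s < n → parity (n ∸ suc s) ⁻¹ ≡ parity (n ∸ s)
  parity-∸-suc {n} {s} s<n = trans (ℙ.⁻¹-selfInverse (ℙ.suc-homo-⁻¹ (n ∸ suc s)))
    (cong parity (sym (+-∸-assoc 1 s<n)))

  -- In layer 0 one step down flips the parity, except that from depth 1 it already reaches the
  -- root. In a higher layer both stations below are within k, save that from the top depth the one
  -- of parity 1ℙ is k + 1 away; a flat step first mends this.
  descends : ∀ i s → s ≤ suc κ → ∃[ b ] Descends b i s ×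
             ((i ≡ 0 × s ≡ 0) ⊎ Descends (b ⁻¹) i s ⊎ DescendsAfterFlat (b ⁻¹) i s)
  descends zero zero    _  = _ , refl , inj₁ (refl , refl)
  descends zero (suc s) s< = _ , refl ,
    inj₂ (inj₂ (s , refl , parity-∸-suc s< , λ _ → refl))
  descends (suc i) s    s≤ with m≤n⇒m<n∨m≡n s≤
  ... | inj₁ s<   = 0ℙ , s≤ , inj₂ (inj₁ s<)
  ... | inj₂ refl = 0ℙ , s≤ , inj₂ (inj₂ (κ , refl , ≤-refl , λ t →
                      layerColour-flat i t (m<m+n (suc i * k) (s≤s z≤n))))

-- The rainbow colouring of the power

module PowerColouring (H : ConnectedGraph) (κ : ℕ) (c : Graph.Vertex (graph H)) (r : ℕ) where
  open ConnectedGraph H using (Vertex; dist; dist-sym)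
  open Distance H
  open Layers κ

  G : Graph
  G = powerGraph H k

  open Graph G hiding (Vertex)

  depth : Vertex → ℕ
  depth v = dist v c

  -- Taking the maximum and minimum of the end depths makes the colour independent of direction.
  χ : EdgeColouring Colour
  χ = fromSymmetric (λ u v → downColour (depth u ⊔ depth v) (depth u ⊓ depth v))
        (λ u v → cong₂ downColour (⊔-comm (depth u) (depth v)) (⊓-comm (depth u) (depth v)))

  open EdgeColouring χ
  open Rainbow G χ

  colour-coords : ∀ {u v} i s {m} (e : u ~ v) → depth u ≡ i * k + suc s → s ≤ suc κ →
                  depth v ≡ m → m ≤ depth u → colour e ≡ layerColour i s m
  colour-coords {u} {v} i s e du s≤ refl m≤ = begin
    downColour (depth u ⊔ depth v) (depth u ⊓ depth v)
      ≡⟨ cong₂ downColour (m≥n⇒m⊔n≡m m≤) (m≥n⇒m⊓n≡n m≤) ⟩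
    downColour (depth u) (depth v)
      ≡⟨ cong (λ d → downColour d (depth v)) du ⟩
    downColour (i * k + suc s) (depth v)
      ≡⟨ downColour-coords i s (depth v) s≤ ⟩
    layerColour i s (depth v) ∎
    where open ≡-Reasoning

  -- A single edge of `G` replaces up to k steps of a geodesic of `H` towards `c`.
  climb : ∀ v j {m} → j ≤ suc κ → depth v ≡ suc j + m → ∃[ u ] v ~ u × depth u ≡ m
  climb v j {m} j≤ dv with between {v} {c} (suc j) dv
  ... | u , vu≤ , du = u , (v≢u , ≤-trans vu≤ (s≤s j≤)) , du
    where
    v≢u : v ≢ u
    v≢u v≡u = m≢1+n+m m (trans (sym du) (trans (cong depth (sym v≡u)) dv))

  Descent : (Colour → Set) → Vertex → Set
  Descent P v = Σ[ w ∈ Walk v c ] Unique (colours w) × All P (colours w)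

  -- The bound `n` makes a rung of index `n` fresh when it is put in front of a descent.
  RungBelow : ℕ → Parity → Colour → Set
  RungBelow n b x = ∃[ i ] i < n × x ≡ rung i b

  NoRung : Parity → Colour → Set
  NoRung b x = ∀ i → x ≢ rung i b

  finish : ∀ {P u v} (e : v ~ u) → u ≡ c → P (colour e) → Descent P v
  finish e refl p = e ◅ ε , [] ∷ [] , p ∷ []

  extend : ∀ {P Q x u v} (e : v ~ u) → colour e ≡ x → (∀ {y} → Q y → x ≢ y) → P x →
           (∀ {y} → Q y → P y) → Descent Q u → Descent P v
  extend e refl fresh p Q⇒P (w , w! , qs) = e ◅ w , All.map fresh qs ∷ w! , p ∷ All.map Q⇒P qs

  weaken : ∀ {P Q v} → (∀ {y} → Q y → P y) → Descent Q v → Descent P v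
  weaken Q⇒P (w , w! , qs) = w , w! , All.map Q⇒P qs

  -- Induction on the layer: a `b`-rung leads to the `b`-station one layer below, which descends in
  -- the same parity.
  descent : ∀ b i s {v} → depth v ≡ i * k + suc s → s ≤ suc κ → Descends b i s →
            Descent (RungBelow (suc i) b) v
  descent b zero s {v} dv s≤ b≡ = case climb v s s≤ (trans dv (sym (+-identityʳ (suc s)))) of λ
    { (u , e , du) → finish {u = u} {v} e (dist≡0⇒≡ {u} {c} du)
        (0 , s≤s z≤n , trans (colour-coords {v} {u} 0 s e dv s≤ du z≤n) (cong (rung 0) (sym b≡))) }
  descent b (suc i) s {v} dv s≤ gap≤ = case climb v (gap b s) gap≤ dv′ of λ
    { (u , e , du) → extend {u = u} {v} e
        (trans (colour-coords {v} {u} (suc i) s e dv s≤ du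
                  (subst (station b i ≤_) (sym dv′) (m≤n+m (station b i) (suc (gap b s)))))
               (layerColour-station b i s))
        (λ { (j , j< , refl) eq → <⇒≢ j< (sym (rung-injectiveˡ eq)) })
        (suc i , ≤-refl , refl)
        (λ { (j , j< , y≡) → j , m≤n⇒m≤1+n j< , y≡ })
        (descent b i (offset b) du (offset≤ b) (descends-station b i)) }
    where
    dv′ : depth v ≡ suc (gap b s) + station b i
    dv′ = trans dv (gap-station b i s)

  rungBelow⇒noRung : ∀ {n b b′ x} → b ≢ b′ → RungBelow n b x → NoRung b′ x
  rungBelow⇒noRung b≢b′ (i , _ , x≡) j x≡′ = b≢b′ (rung-injectiveʳ (trans (sym x≡) x≡′))

  opposite⇒noRung : ∀ {n b x} → RungBelow n (b ⁻¹) x → NoRung b x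
  opposite⇒noRung {b = b} = rungBelow⇒noRung (ℙ.p≢p⁻¹ b ∘ sym)

  -- The flat edge is no rung, hence differs from all later colours and respects `NoRung b`.
  descentAfterFlat : ∀ b i s {v} → depth v ≡ i * k + suc s → s ≤ suc κ →
                     DescendsAfterFlat (b ⁻¹) i s → Descent (NoRung b) v
  descentAfterFlat b i s {v} dv s≤ (s′ , s≡ , desc , flat≡) = case climb v 0 z≤n dv′ of λ
    { (u , e , du) → extend {u = u} {v} e
        (trans (colour-coords {v} {u} i s e dv s≤ du
                  (subst (i * k + s ≤_) (sym dv′) (n≤1+n (i * k + s))))
               (flat≡ s))
        (λ { (_ , _ , refl) () })
        (λ _ ())
        opposite⇒noRung
        (descent (b ⁻¹) i s′ (trans du (cong (i * k +_) s≡)) (≤-trans s′≤s s≤) desc) }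
    where
    dv′ : depth v ≡ suc (i * k + s)
    dv′ = trans dv (+-suc (i * k) s)
    s′≤s : s′ ≤ s
    s′≤s = subst (s′ ≤_) (sym s≡) (n≤1+n s′)

  data Descents (v : Vertex) : Set where
    descents : ∀ n b → Descent (RungBelow n b) v → depth v ≡ 1 ⊎ Descent (NoRung b) v → Descents v

  descentsOf : ∀ v → Descents v
  descentsOf v with depth v in dv
  -- The root descends by the empty walk, so the parity chosen is arbitrary.
  ... | zero with dist≡0⇒≡ {v} {c} dv
  ...   | refl = descents 0 0ℙ (ε , [] , []) (inj₂ (ε , [] , []))
  descentsOf v | suc e with descends (e / k) (e % k) (s≤s⁻¹ (m%n<n e k))
  ... | b , desc , other = descents (suc (e / k)) b (descent b (e / k) (e % k) coords s≤ desc) (complement other)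
    where
    s≤ : e % k ≤ suc κ
    s≤ = s≤s⁻¹ (m%n<n e k)
    coords : depth v ≡ e / k * k + suc (e % k)
    coords = trans dv (trans (cong suc (m≡m%n+[m/n]*n e k)) (+-comm (suc (e % k)) (e / k * k)))
    complement : (e / k ≡ 0 × e % k ≡ 0) ⊎ Descends (b ⁻¹) (e / k) (e % k)
                   ⊎ DescendsAfterFlat (b ⁻¹) (e / k) (e % k) →
                 depth v ≡ 1 ⊎ Descent (NoRung b) v
    complement (inj₁ (i≡0 , s≡0)) =
      inj₁ (trans coords (cong₂ (λ i s → i * k + suc s) i≡0 s≡0))
    complement (inj₂ (inj₁ desc′)) =
      inj₂ (weaken opposite⇒noRung (descent (b ⁻¹) (e / k) (e % k) coords s≤ desc′))
    complement (inj₂ (inj₂ after)) = inj₂ (descentAfterFlat b (e / k) (e % k) coords s≤ after)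

  join : ∀ {n b u v} → Descent (RungBelow n b) u → Descent (NoRung b) v → RainbowPath u v
  join (w , w! , below) (w′ , w′! , none) = joinAt w w′ w! w′! λ { (x∈w , x∈w′) →
    case All.lookup below x∈w of λ { (i , _ , x≡) → All.lookup none x∈w′ i x≡ } }

  adjacent : ∀ u v → depth u ≡ 1 → depth v ≡ 1 → RainbowPath u v
  adjacent u v du dv with u ≟ v
  ... | yes refl = proj₁ (shortcut ε [])
  ... | no  u≢v  = proj₁ (shortcut ((u≢v , uv≤) ◅ ε) ([] ∷ []))
    where
    uv≤ : dist u v ≤ k
    uv≤ = begin
      dist u v            ≤⟨ dist-triangle u c v ⟩
      dist u c + dist c v ≤⟨ +-mono-≤ (≤-reflexive du) (≤-trans (dist-sym c v) (≤-reflexive dv)) ⟩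
      2                   ≤⟨ s≤s (s≤s z≤n) ⟩
      k                   ∎
      where open ≤-Reasoning

  -- Rungs of opposite parities never clash. For equal parities one end switches to its alternative
  -- descent; only when both have depth 1 is neither able to.
  χ-rainbow : IsRainbowColouring
  χ-rainbow u v with descentsOf u | descentsOf v
  ... | descents _ b d other | descents _ b′ d′ other′ with b ℙ.≟ b′
  ...   | no b≢b′ = join d (weaken (rungBelow⇒noRung (b≢b′ ∘ sym)) d′)
  ...   | yes refl with other | other′
  ...     | _       | inj₂ d″ = join d d″
  ...     | inj₂ d″ | inj₁ _  = rainbowPath-sym (join d′ d″)
  ...     | inj₁ du | inj₁ dv = adjacent u v du dv

  hasRainbowColouring-power : (∀ v → depth v ≤ r * k) → HasRainbowColouring (2 * r + 1)
  hasRainbowColouring-power depth≤ = relabel rank rank-injective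
    (λ {u} {v} _ → rank-downColour< {r} (depth u ⊓ depth v) (⊔-lub (depth≤ u) (depth≤ v))) χ-rainbow

-- Distances in a graph and in its power, and the theorem

module _ (H : ConnectedGraph) (k : ℕ) where
  open ConnectedGraph H using (dist)
  open Distance H

  dist≤length*k : ∀ {u v} (w : Graph.Walk (powerGraph H k) u v) →
                  dist u v ≤ Graph.length (powerGraph H k) w * k
  dist≤length*k {u} ε = ≤-reflexive (dist-refl u)
  dist≤length*k {u} {v} (_◅_ {j = x} (_ , d≤k) w) =
    ≤-trans (dist-triangle u x v) (+-mono-≤ d≤k (dist≤length*k w))

  dist≤dist-power*k : ∀ 1≤k u v → dist u v ≤ ConnectedGraph.dist (power H k 1≤k) u v * k
  dist≤dist-power*k 1≤k u v with Distance.geodesic (power H k 1≤k) u v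
  ... | w , eq = subst (λ d → dist u v ≤ d * k) eq (dist≤length*k w)

theorem1 : (H : ConnectedGraph) → Graph.NonTrivial (graph H) →
    ∀ k (k≥2 : 2 ≤ k) →
    let Hᵏ = power H k (<⇒≤ k≥2) in
    radius Hᵏ ≤ rc Hᵏ × rc Hᵏ ≤ 2 * radius Hᵏ + 1
theorem1 H n≥2 k@(suc (suc κ)) k≥2@(s≤s (s≤s z≤n)) = radius≤rc (<⇒≤ n≥2) , upper
  where
  Hᵏ : ConnectedGraph
  Hᵏ = power H k (<⇒≤ k≥2)
  open Distance Hᵏ

  upper : rc Hᵏ ≤ 2 * radius Hᵏ + 1
  upper with centre (<⇒≤ n≥2)
  ... | c , r≡ecc = rc≤ (PowerColouring.hasRainbowColouring-power H κ c (radius Hᵏ) λ v → begin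
    -- Depth is measured towards `c` but eccentricity from `c`, hence the symmetry step.
    ConnectedGraph.dist H v c        ≤⟨ ConnectedGraph.dist-sym H v c ⟩
    ConnectedGraph.dist H c v        ≤⟨ dist≤dist-power*k H k (<⇒≤ k≥2) c v ⟩
    ConnectedGraph.dist Hᵏ c v * k   ≤⟨ *-monoˡ-≤ k (dist≤ecc c v) ⟩
    ConnectedGraph.ecc Hᵏ c * k      ≡⟨ cong (_* k) r≡ecc ⟨
    radius Hᵏ * k                    ∎)
    where open ≤-Reasoning
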